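{- Let $k\geq 4$ be a fixed integer. Then almost all $n$-ary trees $T(n,k)$ with $n\geq 2$ satisfy $\chi_L(T(n,k))=n+k-1$; that is, there are only finitely many integers $n\geq 2$ such that $\chi_L(T(n,k))<n+k-1$.
   Context: All graphs are simple, undirected and connected. A $k$-coloring of a graph $G$ is a map $c:V(G)\to\{1,\dots,k\}$ with $c(u)\neq c(v)$ whenever $u,v$ are adjacent. If $\Pi=\{C_1,\dots,C_k\}$ is the partition of $V(G)$ into color classes ($C_i=c^{ -1}(i)$), the color code of a vertex $v$ is $c_\Pi(v)=(d(v,C_1),\dots,d(v,C_k))$, where $d(v,C_i)=\min\{d(v,x):x\in C_i\}$ and $d$ is the graph distance. The coloring $c$ is a locating $k$-coloring if all vertices of $G$ have distinct color codes. The locating-chromatic number $\chi_L(G)$ is the smallest $k$ such that $G$ has a locating $k$-coloring. For integers $n\geq 2$, $k\geq 1$, the $k$-level $n$-ary tree $T(n,k)$ is defined recursively: $T(n,1)$ is the star $K_{1,n}$ (a center vertex joined to $n$ leaves), and for $k\geq 2$, $T(n,k)$ is obtained from $n$ disjoint copies of $T(n,k-1)$ by adding a new vertex adjacent to the center of each copy; this new vertex is the center of $T(n,k)$. -}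

module Defs where

open import Data.Nat using (ℕ; zero; suc; _≤_; _<_)
open import Data.Fin using (Fin)
open import Data.Product using (Σ; ∃; ∃-syntax; _×_; _,_)
open import Relation.Binary.PropositionalEquality using (_≡_; _≢_)
open import Relation.Nullary using (¬_)

record Graph : Set₁ where
  field
    V   : Set
    Adj : V → V → Set
open Graph public

data Walk (G : Graph) : V G → V G → ℕ → Set where
  nil  : ∀ {u} → Walk G u u 0
  cons : ∀ {u w v ℓ} → Adj G u w → Walk G w v ℓ → Walk G u v (suc ℓ)

IsColoring : (G : Graph) (k : ℕ) → (V G → Fin k) → Set
IsColoring G k c = ∀ {u v} → Adj G u v → c u ≢ c v

-- DistToClass G c v i m :  d(v, C_i) = m  where C_i = c⁻¹(i)
-- (only holds when C_i is nonempty; an empty class is at distance ∞ from every vertex).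
DistToClass : (G : Graph) {k : ℕ} → (V G → Fin k) → V G → Fin k → ℕ → Set
DistToClass G c v i m =
  (∃[ x ] (c x ≡ i × Walk G v x m))
  × (∀ x ℓ → c x ≡ i → Walk G v x ℓ → m ≤ ℓ)

CodesDiffer : (G : Graph) {k : ℕ} → (V G → Fin k) → V G → V G → Set
CodesDiffer G c u v =
  ∃[ i ] ∃[ m ] ∃[ m' ] (DistToClass G c u i m × DistToClass G c v i m' × m ≢ m')

IsLocatingColoring : (G : Graph) (k : ℕ) → (V G → Fin k) → Set
IsLocatingColoring G k c =
  IsColoring G k c × (∀ u v → u ≢ v → CodesDiffer G c u v)

HasLocatingColoring : Graph → ℕ → Set
HasLocatingColoring G k = Σ (V G → Fin k) (IsLocatingColoring G k)

LocatingChromaticNumber : Graph → ℕ → Set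
LocatingChromaticNumber G χ =
  HasLocatingColoring G χ × (∀ k → k < χ → ¬ HasLocatingColoring G k)

-- The k-level n-ary tree T(n,k), built recursively.
-- TV n 0 is a single vertex; TV n (suc k) has a new center plus n copies of TV n k.
-- (So TV n 1 is the star K_{1,n}, matching T(n,1).)
data TV (n : ℕ) : ℕ → Set where
  center : ∀ {k} → TV n k
  sub    : ∀ {k} → Fin n → TV n k → TV n (suc k)

data TAdj (n : ℕ) : (k : ℕ) → TV n k → TV n k → Set where
  down   : ∀ {k} (i : Fin n) → TAdj n (suc k) center (sub i center)
  up     : ∀ {k} (i : Fin n) → TAdj n (suc k) (sub i center) center
  inside : ∀ {k} (i : Fin n) {u v : TV n k} → TAdj n k u v → TAdj n (suc k) (sub i u) (sub i v)

T : ℕ → ℕ → Graph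
T n k = record { V = TV n k ; Adj = TAdj n k }

{-# OPTIONS --safe #-}
module Submission where

-- Lower bound.  The n leaves below a stem have distinct colours, so with n + E colours, E = k - 2, all
-- but at most E entries of a stem's code equal 1.  As distances are at most 2k, there are O(n^E) such
-- codes, too few for the n^(k-1) stems.
--
-- Upper bound.  The tree is coloured recursively: the i-th branch carries the colouring of the smaller
-- tree, embedded in the larger palette so as to miss exactly the colour p i, which is the colour of the
-- root of another branch.  Every vertex at depth d ≥ 1 is then within d + 1 of every colour, while a
-- vertex at depth d in branch i is at distance d + 1 from p i.  This separates vertices of different
-- branches: by p of the deeper vertex's branch when the depths differ, and at equal depth d ≥ 2 because
-- the other branch, having p i in its own palette, meets it within d.

open import Defs
open import Data.Nat using (ℕ; zero; suc; _≤_; _<_; _+_; _∸_; _*_; _^_; _⊔_; z≤n; s≤s; s≤s⁻¹; >-nonZero)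
open import Data.Nat.Properties as ℕ using (≤-refl; ≤-trans; m≤n⇒m≤1+n)
open import Data.Fin using (Fin; zero; suc; toℕ; fromℕ; fromℕ<; inject₁; inject≤; punchIn; punchOut;
  combine; funToFin; finToFun)
open import Data.Fin.Properties as Fin using (_≟_)
open import Data.Fin.Permutation as Perm using (Permutation′; _⟨$⟩ʳ_; _⟨$⟩ˡ_; inverseˡ; inverseʳ)
open import Data.Product using (Σ; ∃; ∃-syntax; ∃₂; _×_; _,_; proj₁; proj₂)
open import Data.Sum using (_⊎_; inj₁; inj₂)
open import Function using (_∘_; Injective; case_of_)
open import Relation.Binary using (tri<; tri≈; tri>)
open import Relation.Binary.PropositionalEquality
  using (_≡_; _≢_; refl; sym; trans; cong; cong₂; subst)
open import Relation.Nullary using (¬_; Dec; yes; no; contradiction)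
open import Relation.Nullary.Decidable using (map′; ¬?; _×-dec_; _⊎-dec_)

private
  variable
    n k N ℓ ℓ′ : ℕ

-- Walks and distances in T(n,k)

-- If nothing below `b` is found, `b` is returned untested; hence `least-holds` asks for a witness
-- up to `b`.
least : {P : ℕ → Set} → (∀ m → Dec (P m)) → ℕ → ℕ
least P? zero    = 0
least P? (suc b) with P? 0
... | yes _ = 0
... | no  _ = suc (least (P? ∘ suc) b)

least≤ : {P : ℕ → Set} (P? : ∀ m → Dec (P m)) (b : ℕ) → least P? b ≤ b
least≤ P? zero    = z≤n
least≤ P? (suc b) with P? 0
... | yes _ = z≤n
... | no  _ = s≤s (least≤ (P? ∘ suc) b)

least-holds : {P : ℕ → Set} (P? : ∀ m → Dec (P m)) (b : ℕ) {m : ℕ} → m ≤ b → P m → P (least P? b)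
least-holds P? zero    z≤n p = p
least-holds P? (suc b) m≤b p with P? 0
least-holds P? (suc b) m≤b p             | yes p₀ = p₀
least-holds P? (suc b) {zero}  m≤b p     | no ¬p₀ = contradiction p ¬p₀
least-holds P? (suc b) {suc m} (s≤s m≤b) p | no ¬p₀ = least-holds (P? ∘ suc) b m≤b p

least-minimal : {P : ℕ → Set} (P? : ∀ m → Dec (P m)) (b : ℕ) {m : ℕ} → P m → least P? b ≤ m
least-minimal P? zero    p = z≤n
least-minimal P? (suc b) p with P? 0
least-minimal P? (suc b) p         | yes _ = z≤n
least-minimal P? (suc b) {zero}  p | no ¬p₀ = contradiction p ¬p₀
least-minimal P? (suc b) {suc m} p | no ¬p₀ = s≤s (least-minimal (P? ∘ suc) b p)

depth : TV n k → ℕ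
depth center    = 0
depth (sub i v) = suc (depth v)

depth≤ : (v : TV n k) → depth v ≤ k
depth≤ center    = z≤n
depth≤ (sub i v) = s≤s (depth≤ v)

sub-injectiveˡ : ∀ {i j : Fin n} {u v : TV n k} → sub i u ≡ sub j v → i ≡ j
sub-injectiveˡ refl = refl

sub-injectiveʳ : ∀ {i j : Fin n} {u v : TV n k} → sub i u ≡ sub j v → u ≡ v
sub-injectiveʳ refl = refl

any-vertex? : ∀ k {P : TV n k → Set} → (∀ v → Dec (P v)) → Dec (∃ P)
any-vertex? zero    P? = map′ (center ,_) (λ { (center , p) → p }) (P? center)
any-vertex? (suc k) P? =
  map′ (λ { (inj₁ p) → center , p ; (inj₂ (i , v , p)) → sub i v , p })
       (λ { (center , p) → inj₁ p ; (sub i v , p) → inj₂ (i , v , p) })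
       (P? center ⊎-dec Fin.any? (λ i → any-vertex? k (P? ∘ sub i)))

adj? : (u v : TV n k) → Dec (TAdj n k u v)
adj? center center                 = no λ ()
adj? center (sub i center)         = yes (down i)
adj? center (sub i (sub j v))      = no λ ()
adj? (sub i center) center         = yes (up i)
adj? (sub i (sub j u)) center      = no λ ()
adj? (sub i u) (sub j v) with i ≟ j
... | no i≢j   = no λ { (inside _ _) → i≢j refl }
... | yes refl = map′ (inside i) (λ { (inside _ a) → a }) (adj? u v)

Reach : (TV n k → Fin N) → TV n k → Fin N → ℕ → Set
Reach {n} {k} c v x ℓ = ∃[ y ] (c y ≡ x × Walk (T n k) v y ℓ)

reach? : (c : TV n k → Fin N) → ∀ v x ℓ → Dec (Reach c v x ℓ)
reach? c v x zero = map′ (λ eq → v , eq , nil) (λ { (_ , eq , nil) → eq }) (c v ≟ x)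
reach? {k = k} c v x (suc ℓ) =
  map′ (λ { (w , a , y , eq , W) → y , eq , cons a W })
       (λ { (y , eq , cons a W) → _ , a , y , eq , W })
       (any-vertex? k (λ w → adj? v w ×-dec reach? c w x ℓ))

dist-exists : (c : TV n k → Fin N) → ∀ {v x} → Reach c v x ℓ → ∃[ m ] DistToClass (T n k) c v x m
dist-exists {ℓ = ℓ} c {v} {x} r =
  least (reach? c v x) ℓ , least-holds (reach? c v x) ℓ ≤-refl r ,
  λ y ℓ′ eq W → least-minimal (reach? c v x) ℓ (y , eq , W)

_++ʷ_ : ∀ {G u v w} → Walk G u v ℓ → Walk G v w ℓ′ → Walk G u w (ℓ + ℓ′)
nil      ++ʷ W′ = W′
cons a W ++ʷ W′ = cons a (W ++ʷ W′)

insideʷ : ∀ (i : Fin n) {u v} → Walk (T n k) u v ℓ → Walk (T n (suc k)) (sub i u) (sub i v) ℓ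
insideʷ i nil        = nil
insideʷ i (cons a W) = cons (inside i a) (insideʷ i W)

ascend : (v : TV n k) → Walk (T n k) v center (depth v)
ascend center    = nil
ascend {n = n} {k = suc k} (sub i v) =
  subst (Walk (T n (suc k)) _ _) (ℕ.+-comm (depth v) 1) (insideʷ i (ascend v) ++ʷ cons (up i) nil)

descend : (v : TV n k) → Walk (T n k) center v (depth v)
descend center    = nil
descend (sub i v) = cons (down i) (insideʷ i (descend v))

adjacent-depth : {u v : TV n k} → TAdj n k u v → depth u ≤ suc (depth v)
adjacent-depth (down i)     = z≤n
adjacent-depth (up i)       = ≤-refl
adjacent-depth (inside i a) = s≤s (adjacent-depth a)

-- The edge above its root is the only way out of a branch, and each step inside lowers the depth by
-- at most one.
stay-or-exit : ∀ {i : Fin n} {v : TV n k} {y} → Walk (T n (suc k)) (sub i v) y ℓ →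
  (∃[ y′ ] (y ≡ sub i y′ × Walk (T n k) v y′ ℓ)) ⊎
  (∃[ ℓ′ ] (Walk (T n (suc k)) center y ℓ′ × suc (depth v + ℓ′) ≤ ℓ))
stay-or-exit nil              = inj₁ (_ , refl , nil)
stay-or-exit (cons (up i) W)  = inj₂ (_ , W , ≤-refl)
stay-or-exit (cons (inside i a) W) with stay-or-exit W
... | inj₁ (y′ , eq , W′) = inj₁ (y′ , eq , cons a W′)
... | inj₂ (ℓ′ , W′ , le) =
  inj₂ (ℓ′ , W′ , s≤s (≤-trans (ℕ.+-monoˡ-≤ ℓ′ (adjacent-depth a)) le))

-- Too few colours

-- A trivial walk is matched by the equal colour; any longer walk can start at the other twin once
-- its first edge is exchanged.
twins-not-separated : ∀ {G} (c : V G → Fin N) {u v} → c u ≡ c v →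
  (∀ w → Adj G u w → Adj G v w) → (∀ w → Adj G v w → Adj G u w) → ¬ CodesDiffer G c u v
twins-not-separated {G = G} c {u} {v} cu≡cv uw⇒vw vw⇒uw
  (x , m , m′ , ((y , cy , W) , minᵤ) , ((y′ , cy′ , W′) , minᵥ) , m≢m′) =
  m≢m′ (ℕ.≤-antisym (transfer (sym cu≡cv) vw⇒uw cy′ W′ minᵤ) (transfer cu≡cv uw⇒vw cy W minᵥ))
  where
  transfer : ∀ {a b y ℓ m} → c a ≡ c b → (∀ w → Adj G a w → Adj G b w) → c y ≡ x → Walk G a y ℓ →
    (∀ z ℓ′ → c z ≡ x → Walk G b z ℓ′ → m ≤ ℓ′) → m ≤ ℓ
  transfer ca≡cb a⇒b cy nil        min = min _ _ (trans (sym ca≡cb) cy) nil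
  transfer ca≡cb a⇒b cy (cons e W) min = min _ _ cy (cons (a⇒b _ e) W)

stem : ∀ K → (Fin K → Fin n) → TV n (suc K)
stem zero    p = center
stem (suc K) p = sub (p zero) (stem K (p ∘ suc))

leaf : ∀ K → (Fin K → Fin n) → Fin n → TV n (suc K)
leaf zero    p j = sub j center
leaf (suc K) p j = sub (p zero) (leaf K (p ∘ suc) j)

stem-injective : ∀ K {p q : Fin K → Fin n} → stem K p ≡ stem K q → ∀ t → p t ≡ q t
stem-injective (suc K) eq zero    = sub-injectiveˡ eq
stem-injective (suc K) eq (suc t) = stem-injective K (sub-injectiveʳ eq) t

leaf-injective : ∀ K (p : Fin K → Fin n) {i j} → leaf K p i ≡ leaf K p j → i ≡ j
leaf-injective zero    p eq = sub-injectiveˡ eq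
leaf-injective (suc K) p eq = leaf-injective K (p ∘ suc) (sub-injectiveʳ eq)

stem-leaf : ∀ K (p : Fin K → Fin n) j → TAdj n (suc K) (stem K p) (leaf K p j)
stem-leaf zero    p j = down j
stem-leaf (suc K) p j = inside (p zero) (stem-leaf K (p ∘ suc) j)

leaf-stem : ∀ K (p : Fin K → Fin n) j → TAdj n (suc K) (leaf K p j) (stem K p)
leaf-stem zero    p j = up j
leaf-stem (suc K) p j = inside (p zero) (leaf-stem K (p ∘ suc) j)

leaf-neighbour : ∀ K (p : Fin K → Fin n) j {w} → TAdj n (suc K) (leaf K p j) w → w ≡ stem K p
leaf-neighbour zero          p j (up _)       = refl
leaf-neighbour (suc zero)    p j (inside _ a) = cong (sub _) (leaf-neighbour zero (p ∘ suc) j a)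
leaf-neighbour (suc (suc K)) p j (inside _ a) = cong (sub _) (leaf-neighbour (suc K) (p ∘ suc) j a)

-- The enumeration g may repeat colours or list values of h.
cover-complement : ∀ {n N} E (h : Fin n → Fin N) → Injective _≡_ _≡_ h → Fin N → N ≤ n + E →
  Σ (Fin E → Fin N) λ g → ∀ x → (∃[ j ] h j ≡ x) ⊎ (∃[ t ] g t ≡ x)
cover-complement {n} {N} E h inj default N≤n+E with Fin.any? (λ x → ¬? (Fin.any? (λ j → h j ≟ x)))
... | no none = (λ (_ : Fin E) → default) , λ x → case Fin.any? (λ j → h j ≟ x) of λ where
        (yes hit) → inj₁ hit
        (no miss) → contradiction (x , miss) none
... | yes (x , miss) = extend E N≤n+E
  where
  h⁺ : Fin (suc n) → Fin N
  h⁺ zero    = x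
  h⁺ (suc j) = h j

  inj⁺ : Injective _≡_ _≡_ h⁺
  inj⁺ {zero}  {zero}  eq = refl
  inj⁺ {zero}  {suc j} eq = contradiction (j , sym eq) miss
  inj⁺ {suc i} {zero}  eq = contradiction (i , eq) miss
  inj⁺ {suc i} {suc j} eq = cong suc (inj eq)

  -- A missed colour joins `h` and takes one of the `E` slots. With no slot left, `h⁺` would inject
  -- `n + 1` elements into at most `n` colours.
  extend : ∀ E → N ≤ n + E → Σ (Fin E → Fin N) λ g → ∀ y → (∃[ j ] h j ≡ y) ⊎ (∃[ t ] g t ≡ y)
  extend zero N≤ = contradiction
    (≤-trans (Fin.injective⇒≤ inj⁺) (≤-trans N≤ (ℕ.≤-reflexive (ℕ.+-identityʳ n)))) ℕ.1+n≰n
  extend (suc E) N≤ with cover-complement E h⁺ inj⁺ default (≤-trans N≤ (ℕ.≤-reflexive (ℕ.+-suc n E)))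
  ... | g , covers = g⁺ , covers⁺
    where
    g⁺ : Fin (suc E) → Fin N
    g⁺ zero    = x
    g⁺ (suc t) = g t

    covers⁺ : ∀ y → (∃[ j ] h j ≡ y) ⊎ (∃[ t ] g⁺ t ≡ y)
    covers⁺ y with covers y
    ... | inj₁ (zero  , eq) = inj₂ (zero , eq)
    ... | inj₁ (suc j , eq) = inj₁ (j , eq)
    ... | inj₂ (t , eq)     = inj₂ (suc t , eq)

module _ {n K N : ℕ} (c : TV n (suc K) → Fin N) (locating : IsLocatingColoring (T n (suc K)) N c) where

  private
    G : Graph
    G = T n (suc K)

    diameter : ℕ
    diameter = suc K + suc K

  -- Bounding the entries puts codes in a finite type. An empty class gets the entry `diameter`;
  -- `code-dist` concerns nonempty classes only.
  code : TV n (suc K) → Fin N → Fin (suc diameter)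
  code v x = fromℕ< (s≤s (least≤ (reach? c v x) diameter))

  code-least : ∀ v x → toℕ (code v x) ≡ least (reach? c v x) diameter
  code-least v x = Fin.toℕ-fromℕ< _

  code-dist : ∀ {v x m} → DistToClass G c v x m → toℕ (code v x) ≡ m
  code-dist {v} {x} {m} ((y , cy , W) , min) = trans (code-least v x) (ℕ.≤-antisym
    (least-minimal (reach? c v x) diameter (y , cy , W))
    (let (z , cz , W′) = least-holds (reach? c v x) diameter m≤diameter (y , cy , W)
     in min z _ cz W′))
    where
    m≤diameter : m ≤ diameter
    m≤diameter = ≤-trans (min y _ cy (ascend v ++ʷ descend y)) (ℕ.+-mono-≤ (depth≤ v) (depth≤ y))

  code-injective : ∀ {u v} → (∀ x → code u x ≡ code v x) → ¬ (u ≢ v)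
  code-injective same u≢v with proj₂ locating _ _ u≢v
  ... | x , m , m′ , dᵤ , dᵥ , m≢m′ =
    m≢m′ (trans (sym (code-dist dᵤ)) (trans (cong toℕ (same x)) (code-dist dᵥ)))

  -- Leaves below one stem are twins, so with equal colours they could not be separated.
  leaf-colours-injective : ∀ p → Injective _≡_ _≡_ (c ∘ leaf K p)
  leaf-colours-injective p {i} {j} eq with i ≟ j
  ... | yes i≡j = i≡j
  ... | no  i≢j = contradiction (proj₂ locating _ _ (i≢j ∘ leaf-injective K p))
    (twins-not-separated c eq (transfer i j) (transfer j i))
    where
    transfer : ∀ i j w → TAdj n (suc K) (leaf K p i) w → TAdj n (suc K) (leaf K p j) w
    transfer i j w a = subst (TAdj n (suc K) (leaf K p j)) (sym (leaf-neighbour K p i a)) (leaf-stem K p j)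

  code-leaf-colour : ∀ p j → toℕ (code (stem K p) (c (leaf K p j))) ≡ 1
  code-leaf-colour p j = code-dist
    ( (leaf K p j , refl , cons (stem-leaf K p j) nil)
    , λ { y .0 eq nil → contradiction eq (proj₁ locating (stem-leaf K p j))
        ; y _ eq (cons _ _) → s≤s z≤n })

  -- A `summary` determines the code of a stem, and there are fewer summaries than stems. It lists
  -- the exceptional colours besides their entries, because these colours vary from stem to stem.
  few-colours-impossible : ∀ E → N ≤ n + E → ¬ ((N * suc diameter) ^ E < n ^ K)
  few-colours-impossible E N≤n+E few =
    let (i , j , i<j , eq) = Fin.pigeonhole few (summary ∘ finToFun {n} {K})
    in code-injective (same-code eq) λ st≡ →
         Fin.<⇒≢ i<j (finToFun-injective i j (stem-injective K st≡))
    where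
    finToFun-injective : ∀ (i j : Fin (n ^ K)) → (∀ t → finToFun {n} {K} i t ≡ finToFun {n} {K} j t) → i ≡ j
    finToFun-injective i j eq = trans (sym (Fin.funToFin-finToFin {K} {n} i))
      (trans (funToFin-cong eq) (Fin.funToFin-finToFin {K} {n} j))
      where
      funToFin-cong : ∀ {m} {f g : Fin m → Fin n} → (∀ t → f t ≡ g t) → funToFin f ≡ funToFin g
      funToFin-cong {zero}  eq = refl
      funToFin-cong {suc m} eq = cong₂ combine (eq zero) (funToFin-cong (eq ∘ suc))

    exceptions : ∀ p → Σ (Fin E → Fin N) λ g → ∀ x → (∃[ j ] c (leaf K p j) ≡ x) ⊎ (∃[ t ] g t ≡ x)
    -- `c center` is only a filler for slots that no missed colour takes.
    exceptions p = cover-complement E (c ∘ leaf K p) (leaf-colours-injective p) (c center) N≤n+E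

    exceptional : (p : Fin K → Fin n) → Fin E → Fin N
    exceptional p = proj₁ (exceptions p)

    entry : (p : Fin K → Fin n) → Fin E → Fin (N * suc diameter)
    entry p t = combine (exceptional p t) (code (stem K p) (exceptional p t))

    summary : (p : Fin K → Fin n) → Fin ((N * suc diameter) ^ E)
    summary p = funToFin (entry p)

    same-code : ∀ {p q} → summary p ≡ summary q → ∀ x → code (stem K p) x ≡ code (stem K q) x
    same-code {p} {q} eq x = agree (proj₂ (exceptions p) x) (proj₂ (exceptions q) x)
      where
      same-entry : ∀ t → entry p t ≡ entry q t
      same-entry t = trans (sym (Fin.finToFun-funToFin (entry p) t))
        (trans (cong (λ s → finToFun s t) eq) (Fin.finToFun-funToFin (entry q) t))

      same-exceptional : ∀ t → exceptional p t ≡ exceptional q t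
      same-exceptional t = Fin.combine-injectiveˡ _ _ _ _ (same-entry t)

      same-value : ∀ t → code (stem K p) (exceptional p t) ≡ code (stem K q) (exceptional q t)
      same-value t = Fin.combine-injectiveʳ (exceptional p t) _ (exceptional q t) _ (same-entry t)

      -- A colour listed for one stem is listed for both, with the same entry; any other colour is a
      -- leaf colour at both stems, with entry 1.
      agree : (∃[ j ] c (leaf K p j) ≡ x) ⊎ (∃[ t ] exceptional p t ≡ x) →
              (∃[ j ] c (leaf K q j) ≡ x) ⊎ (∃[ t ] exceptional q t ≡ x) →
              code (stem K p) x ≡ code (stem K q) x
      agree (inj₂ (t , refl)) _ = trans (same-value t) (cong (code (stem K q)) (sym (same-exceptional t)))
      agree _ (inj₂ (t , refl)) = trans (cong (code (stem K p)) (sym (same-exceptional t))) (same-value t)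
      agree (inj₁ (i , eqᵢ)) (inj₁ (j , eqⱼ)) = Fin.toℕ-injective (trans
        (subst (λ y → toℕ (code (stem K p) y) ≡ 1) eqᵢ (code-leaf-colour p i))
        (sym (subst (λ y → toℕ (code (stem K q) y) ≡ 1) eqⱼ (code-leaf-colour q j))))

-- The recursive colouring

-- A `Nice` colouring has colours 0 and 1 at the centre and at one of its children. When the tree
-- becomes a branch, these turn into `a` and `b`, and `d` is the one colour the branch lacks.
record Embedding (a b d : Fin (3 + N)) : Set where
  field
    embed      : Fin (2 + N) → Fin (3 + N)
    embed₀     : embed zero ≡ a
    embed₁     : embed (suc zero) ≡ b
    injective  : Injective _≡_ _≡_ embed
    avoids     : ∀ x → embed x ≢ d
    exhaustive : ∀ y → y ≢ d → ∃[ x ] embed x ≡ y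

embedding : (a b d : Fin (3 + N)) → a ≢ b → a ≢ d → b ≢ d → Embedding a b d
embedding {N} a b d a≢b a≢d b≢d = record
  { embed      = λ x → punchIn d (ρ ⟨$⟩ʳ x)
  ; embed₀     = Fin.punchIn-punchOut (a≢d ∘ sym)
  ; embed₁     = trans (cong (punchIn d) (Fin.punchIn-punchOut a′≢b′)) (Fin.punchIn-punchOut (b≢d ∘ sym))
  ; injective  = λ {x} {y} eq → trans (sym (inverseˡ ρ))
      (trans (cong (ρ ⟨$⟩ˡ_) (Fin.punchIn-injective d _ _ eq)) (inverseˡ ρ))
  ; avoids     = λ x → Fin.punchInᵢ≢i d _
  ; exhaustive = λ y y≢d → ρ ⟨$⟩ˡ punchOut (y≢d ∘ sym) ,
      trans (cong (punchIn d) (inverseʳ ρ)) (Fin.punchIn-punchOut (y≢d ∘ sym))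
  }
  where
  a′ b′ : Fin (2 + N)
  a′ = punchOut (a≢d ∘ sym)
  b′ = punchOut (b≢d ∘ sym)

  a′≢b′ : a′ ≢ b′
  a′≢b′ = a≢b ∘ Fin.punchOut-injective (a≢d ∘ sym) (b≢d ∘ sym)

  ρ : Permutation′ (2 + N)
  -- The outer insertion sends 0 to `a′`; the inner one sends 1 to `b′`, renumbered with `a′`
  -- removed.
  ρ = Perm.insert zero a′ (Perm.insert zero (punchOut a′≢b′) Perm.id)

Near : (TV n k → Fin N) → TV n k → Fin N → ℕ → Set
Near c v x b = ∃[ ℓ ] (ℓ ≤ b × Reach c v x ℓ)

Far : (TV n k → Fin N) → TV n k → Fin N → ℕ → Set
Far {n} {k} c v x b = ∀ y ℓ → c y ≡ x → Walk (T n k) v y ℓ → b < ℓ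

-- A walk leaving the tree through its center has length more than depth v, so the bound b ≤ depth v makes
-- the separation survive when the tree becomes a branch of a larger one.
Resolved : (TV n k → Fin N) → TV n k → TV n k → Set
Resolved c u v = ∃₂ λ x b → Near c u x b × Far c v x b × b ≤ depth v

near-weaken : ∀ {c : TV n k → Fin N} {v x b b′} → b ≤ b′ → Near c v x b → Near c v x b′
near-weaken b≤b′ (ℓ , ℓ≤b , r) = ℓ , ≤-trans ℓ≤b b≤b′ , r

near-self : ∀ {c : TV n k → Fin N} {v b} → Near c v (c v) b
near-self = 0 , z≤n , _ , refl , nil

near-adjacent : ∀ {c : TV n k → Fin N} {u v x b} → TAdj n k u v → Near c v x b → Near c u x (suc b)
near-adjacent a (ℓ , ℓ≤b , y , eq , W) = suc ℓ , s≤s ℓ≤b , y , eq , cons a W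

far-0 : ∀ {c : TV n k → Fin N} {v x} → c v ≢ x → Far c v x 0
far-0 c≢ y .0 eq nil        = contradiction eq c≢
far-0 c≢ y _  eq (cons _ _) = s≤s z≤n

far-suc : ∀ {c : TV n k → Fin N} {v x b} → c v ≢ x → (∀ w → TAdj n k v w → Far c w x b) → Far c v x (suc b)
far-suc c≢ far y .0 eq nil            = contradiction eq c≢
far-suc c≢ far y _  eq (cons {w = w} a W) = s≤s (far w a y _ eq W)

resolved-by-colour : ∀ {c : TV n k → Fin N} {u v} → c u ≢ c v → Resolved c u v
resolved-by-colour c≢ = _ , 0 , near-self , far-0 (c≢ ∘ sym) , z≤n

-- The bound in `cover` is `depth v + 1`, except that it is 2 at the centre, where a colour may
-- first appear at a grandchild.
record Nice (c : TV n (suc k) → Fin (2 + N)) : Set where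
  field
    proper  : IsColoring (T n (suc k)) (2 + N) c
    centre  : c center ≡ zero
    child   : ∃[ i ] c (sub i center) ≡ suc zero
    cover   : ∀ v x → Near c v x (suc (1 ⊔ depth v))
    resolve : ∀ u v → u ≢ v → Resolved c u v ⊎ Resolved c v u

-- `Resolved` only bounds the distances. One exists by `Near`, the other by `cover`, and `b`
-- separates them.
nice⇒locating : {c : TV n (suc k) → Fin (2 + N)} → Nice c → IsLocatingColoring (T n (suc k)) (2 + N) c
nice⇒locating {n} {k} {c = c} nice = Nice.proper nice , λ u v u≢v → case Nice.resolve nice u v u≢v of λ where
    (inj₁ r) → differ r
    (inj₂ r) → let (x , m , m′ , d , d′ , m≢m′) = differ r in x , m′ , m , d′ , d , m≢m′ ∘ sym
  where
  differ : ∀ {u v} → Resolved c u v → CodesDiffer (T n (suc k)) c u v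
  differ {u} {v} (x , b , (ℓ , ℓ≤b , r@(y , cy , W)) , far , _) =
    let (m , d@(_ , min))            = dist-exists c r
        (m′ , d′@((z , cz , W′) , _)) = dist-exists c (proj₂ (proj₂ (Nice.cover nice v x)))
    in x , m , m′ , d , d′ , ℕ.<⇒≢ (ℕ.≤-<-trans (≤-trans (min y ℓ cy W) ℓ≤b) (far z m′ cz W′))

-- Branch `i` has colour `q i` at its root and `s i` at a child of the root, and lacks the root
-- colour of branch `σ i`. As `q i` does occur in branch `i`, `σ` must be a derangement.
module Step {n k N : ℕ} {c : TV n (suc k) → Fin (2 + N)} (nice : Nice c)
  (σ : Fin n → Fin n) (σ-injective : Injective _≡_ _≡_ σ) (σ-deranged : ∀ i → σ i ≢ i)
  (q s : Fin n → Fin (3 + N)) (q-injective : Injective _≡_ _≡_ q)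
  (q≢0 : ∀ i → q i ≢ zero) (q≢s : ∀ i j → q i ≢ s j) (i₁ : Fin n) (q-i₁ : q i₁ ≡ suc zero)
  (palette : ∀ x → (x ≡ zero) ⊎ (∃[ i ] q i ≡ x) ⊎ (∃[ i ] s i ≡ x))
  where

  open Nice nice

  p : Fin n → Fin (3 + N)
  p i = q (σ i)

  p-injective : Injective _≡_ _≡_ p
  p-injective = σ-injective ∘ q-injective

  module _ (i : Fin n) where
    open Embedding (embedding (q i) (s i) (p i) (q≢s i i) (λ eq → σ-deranged i (sym (q-injective eq)))
      (q≢s (σ i) i ∘ sym)) public

  c⁺ : TV n (2 + k) → Fin (3 + N)
  c⁺ center    = zero
  c⁺ (sub i v) = embed i (c v)

  c⁺-child : ∀ i → c⁺ (sub i center) ≡ q i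
  c⁺-child i = trans (cong (embed i) centre) (embed₀ i)

  near-lift : ∀ i {v x b} → Near c v x b → Near c⁺ (sub i v) (embed i x) b
  near-lift i (ℓ , ℓ≤b , y , eq , W) = ℓ , ℓ≤b , sub i y , cong (embed i) eq , insideʷ i W

  far-lift : ∀ i {v x b} → Far c v x b → b ≤ depth v → Far c⁺ (sub i v) (embed i x) b
  far-lift i far b≤ y ℓ eq W with stay-or-exit W
  ... | inj₁ (y′ , refl , W′) = far y′ ℓ (injective i eq) W′
  ... | inj₂ (ℓ′ , _ , le)    = ≤-trans (s≤s (≤-trans b≤ (ℕ.m≤m+n _ ℓ′))) le

  -- The walk must exit, and the centre, coloured 0, is still no hit, so one more step follows. The
  -- bound equals the depth of `sub i v`, the largest that `Resolved` permits.
  far-missing : ∀ i v → Far c⁺ (sub i v) (p i) (suc (depth v))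
  far-missing i v y ℓ eq W with stay-or-exit W
  ... | inj₁ (y′ , refl , _)      = contradiction eq (avoids i (c y′))
  ... | inj₂ (_ , nil , _)        = contradiction (sym eq) (q≢0 (σ i))
  ... | inj₂ (suc ℓ′ , cons _ _ , le) =
    ≤-trans (s≤s (≤-trans (s≤s (ℕ.m≤m+n _ ℓ′)) (ℕ.≤-reflexive (sym (ℕ.+-suc _ ℓ′))))) le

  resolve-lift : ∀ i {u v} → Resolved c u v → Resolved c⁺ (sub i u) (sub i v)
  resolve-lift i (x , b , near , far , b≤) =
    embed i x , b , near-lift i near , far-lift i far b≤ , m≤n⇒m≤1+n b≤

  near-child : ∀ i → Near c⁺ center (q i) 1
  near-child i = 1 , ≤-refl , sub i center , c⁺-child i , cons (down i) nil

  near-missing : ∀ i v → Near c⁺ (sub i v) (p i) (2 + depth v)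
  near-missing i v = suc (suc (depth v)) , ≤-refl , sub (σ i) center , c⁺-child (σ i) ,
    subst (Walk (T n (2 + k)) _ _) (ℕ.+-comm (suc (depth v)) 1) (ascend (sub i v) ++ʷ cons (down (σ i)) nil)

  -- Inside its branch `v` is one level higher, so for positive `depth v` the inherited bound beats
  -- that of `cover⁺` by one.
  near-own : ∀ i v x → x ≢ p i → Near c⁺ (sub i v) x (suc (1 ⊔ depth v))
  near-own i v x x≢p with exhaustive i x x≢p
  ... | x′ , refl = near-lift i (cover v x′)

  proper⁺ : IsColoring (T n (2 + k)) (3 + N) c⁺
  proper⁺ (down i)     eq = q≢0 i (trans (sym (c⁺-child i)) (sym eq))
  proper⁺ (up i)       eq = q≢0 i (trans (sym (c⁺-child i)) eq)
  proper⁺ (inside i a) eq = proper a (injective i eq)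

  cover⁺ : ∀ v x → Near c⁺ v x (suc (1 ⊔ depth v))
  cover⁺ center x with palette x
  ... | inj₁ refl              = near-self
  ... | inj₂ (inj₁ (i , refl)) = near-weaken (s≤s z≤n) (near-child i)
  -- The child that has colour 1 within the branch carries `s i` after the embedding.
  ... | inj₂ (inj₂ (i , refl)) = 2 , ≤-refl , sub i (sub (proj₁ child) center) ,
    trans (cong (embed i) (proj₂ child)) (embed₁ i) , cons (down i) (cons (inside i (down _)) nil)
  cover⁺ (sub i v) x with x ≟ p i
  ... | yes refl = near-missing i v
  ... | no  x≢p  = near-weaken (s≤s (ℕ.⊔-lub (s≤s z≤n) (ℕ.n≤1+n _))) (near-own i v x x≢p)

  resolve-center : ∀ i v → Resolved c⁺ center (sub i v)
  resolve-center i v = p i , suc (depth v) , near-weaken (s≤s z≤n) (near-child (σ i)) , far-missing i v , ≤-refl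

  -- By `cover⁺`, the shallower vertex has every colour within its depth plus one, hence within the
  -- depth of the deeper vertex, which has `p j` farther away than that.
  resolve-deeper : ∀ {i j u v} → depth u < depth v → Resolved c⁺ (sub i u) (sub j v)
  resolve-deeper {i} {j} {u} {v} u<v =
    p j , suc (depth v) , near-weaken (s≤s u<v) (cover⁺ (sub i u) (p j)) , far-missing j v , ≤-refl

  resolve-level : ∀ {i j} u v → i ≢ j → depth u ≡ depth v → Resolved c⁺ (sub i u) (sub j v)
  -- At branch roots the bound of `near-own` is 2, one too many, so the distinct root colours must
  -- do.
  resolve-level center center i≢j _ = resolved-by-colour λ eq →
    i≢j (q-injective (trans (sym (c⁺-child _)) (trans eq (c⁺-child _))))
  resolve-level {i} {j} u@(sub _ _) v@(sub _ _) i≢j eq = p j , suc (depth v) ,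
    near-weaken (ℕ.≤-reflexive (cong suc eq)) (near-own i u (p j) (i≢j ∘ sym ∘ p-injective)) ,
    far-missing j v , ≤-refl

  resolve⁺ : ∀ u v → u ≢ v → Resolved c⁺ u v ⊎ Resolved c⁺ v u
  resolve⁺ center    center    u≢v = contradiction refl u≢v
  resolve⁺ center    (sub j v) _   = inj₁ (resolve-center j v)
  resolve⁺ (sub i u) center    _   = inj₂ (resolve-center i u)
  resolve⁺ (sub i u) (sub j v) u≢v with i ≟ j
  ... | yes refl with resolve u v (u≢v ∘ cong (sub i))
  ...   | inj₁ r = inj₁ (resolve-lift i r)
  ...   | inj₂ r = inj₂ (resolve-lift i r)
  resolve⁺ (sub i u) (sub j v) u≢v | no i≢j with ℕ.<-cmp (depth u) (depth v)
  ... | tri< u<v _ _ = inj₁ (resolve-deeper u<v)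
  ... | tri≈ _ eq _  = inj₁ (resolve-level u v i≢j eq)
  ... | tri> _ _ v<u = inj₂ (resolve-deeper v<u)

  nice⁺ : Nice c⁺
  nice⁺ = record
    { proper  = proper⁺
    ; centre  = refl
    ; child   = i₁ , trans (c⁺-child i₁) q-i₁
    ; cover   = cover⁺
    ; resolve = resolve⁺
    }

-- The two-level tree

third-colour : (a b : Fin (3 + N)) → ∃[ x ] (x ≢ a × x ≢ b)
third-colour a b with a ≟ b
... | yes refl = punchIn a zero , Fin.punchInᵢ≢i a _ , Fin.punchInᵢ≢i a _
... | no  a≢b  = punchIn a (punchIn (punchOut a≢b) zero) , Fin.punchInᵢ≢i a _ , λ eq →
  Fin.punchInᵢ≢i (punchOut a≢b) zero (Fin.punchIn-injective a _ _ (trans eq (sym (Fin.punchIn-punchOut a≢b))))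

module Base (m : ℕ) where

  -- The leaves below a child receive all colours but the child's own, so every non-leaf vertex has
  -- all colours within distance 1.
  c₂ : TV (2 + m) 2 → Fin (3 + m)
  c₂ center                   = zero
  c₂ (sub i center)           = suc i
  c₂ (sub i (sub j center))   = punchIn (suc i) j

  near-center : ∀ x → Near c₂ center x 1
  near-center zero    = near-self
  near-center (suc i) = near-adjacent (down i) near-self

  near-stem : ∀ i x → Near c₂ (sub i center) x 1
  near-stem i x with suc i ≟ x
  ... | yes refl = near-self
  ... | no  i≢x  = subst (λ y → Near c₂ (sub i center) y 1) (Fin.punchIn-punchOut i≢x)
    (near-adjacent (inside i (down (punchOut i≢x))) near-self)

  far-leaf : ∀ i j {x} → x ≢ c₂ (sub i (sub j center)) → x ≢ suc i → Far c₂ (sub i (sub j center)) x 1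
  far-leaf i j x≢leaf x≢stem =
    far-suc (x≢leaf ∘ sym) λ { _ (inside _ (up _)) → far-0 (x≢stem ∘ sym) }

  proper₂ : IsColoring (T (2 + m) 2) (3 + m) c₂
  proper₂ (down i)            ()
  proper₂ (up i)              ()
  proper₂ (inside i (down j)) eq = Fin.punchInᵢ≢i (suc i) j (sym eq)
  proper₂ (inside i (up j))   eq = Fin.punchInᵢ≢i (suc i) j eq

  cover₂ : ∀ v x → Near c₂ v x (suc (1 ⊔ depth v))
  cover₂ center                 x = near-weaken (s≤s z≤n) (near-center x)
  cover₂ (sub i center)         x = near-weaken (s≤s z≤n) (near-stem i x)
  cover₂ (sub i (sub j center)) x = near-weaken (s≤s (s≤s z≤n)) (near-adjacent (inside i (up j)) (near-stem i x))

  -- A leaf has only two colours within distance 1, its own and that of its neighbour, while there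
  -- are at least three colours.
  resolve-leaf : ∀ {u} i j → (∀ x → Near c₂ u x 1) → Resolved c₂ u (sub i (sub j center))
  resolve-leaf i j near with third-colour (c₂ (sub i (sub j center))) (suc i)
  ... | x , x≢leaf , x≢stem = x , 1 , near x , far-leaf i j x≢leaf x≢stem , s≤s z≤n

  -- For different stems, consider the colour `suc i` of the first stem. If the second leaf has it,
  -- the leaf colours differ; otherwise only the first leaf has it within distance 1.
  resolve-leaves : ∀ i j i′ j′ → sub i (sub j center) ≢ sub i′ (sub j′ center) →
    Resolved c₂ (sub i (sub j center)) (sub i′ (sub j′ center))
  resolve-leaves i j i′ j′ u≢v with i ≟ i′
  ... | yes refl = resolved-by-colour λ eq →
    u≢v (cong (λ t → sub i (sub {k = 0} t center)) (Fin.punchIn-injective (suc i) j j′ eq))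
  ... | no i≢i′ with punchIn (suc i′) j′ ≟ suc i
  ...   | yes v≡i = resolved-by-colour λ eq → Fin.punchInᵢ≢i (suc i) j (trans eq v≡i)
  ...   | no  v≢i = suc i , 1 , near-adjacent (inside i (up j)) near-self ,
    far-leaf i′ j′ (v≢i ∘ sym) (i≢i′ ∘ Fin.suc-injective) , s≤s z≤n

  resolve₂ : ∀ u v → u ≢ v → Resolved c₂ u v ⊎ Resolved c₂ v u
  resolve₂ center center u≢v = contradiction refl u≢v
  resolve₂ center (sub i center) _ = inj₁ (resolved-by-colour λ ())
  resolve₂ (sub i center) center _ = inj₁ (resolved-by-colour λ ())
  resolve₂ (sub i center) (sub j center) u≢v =
    inj₁ (resolved-by-colour (u≢v ∘ cong (λ t → sub t center) ∘ Fin.suc-injective))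
  resolve₂ center (sub i (sub j center)) _ = inj₁ (resolve-leaf i j near-center)
  resolve₂ (sub i (sub j center)) center _ = inj₂ (resolve-leaf i j near-center)
  resolve₂ (sub i center) (sub i′ (sub j center)) _ = inj₁ (resolve-leaf i′ j (near-stem i))
  resolve₂ (sub i (sub j center)) (sub i′ center) _ = inj₂ (resolve-leaf i j (near-stem i′))
  resolve₂ (sub i (sub j center)) (sub i′ (sub j′ center)) u≢v = inj₁ (resolve-leaves i j i′ j′ u≢v)

  nice₂ : Nice c₂
  nice₂ = record { proper = proper₂ ; centre = refl ; child = zero , refl ; cover = cover₂ ; resolve = resolve₂ }

-- A cyclic derangement and the choice of palettes

rotate : Fin (suc n) → Fin (suc n)
rotate zero    = fromℕ _
rotate (suc i) = inject₁ i

rotate-injective : Injective _≡_ _≡_ (rotate {n})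
rotate-injective {x = zero}  {zero}  eq = refl
rotate-injective {x = zero}  {suc j} eq = contradiction eq Fin.fromℕ≢inject₁
rotate-injective {x = suc i} {zero}  eq = contradiction (sym eq) Fin.fromℕ≢inject₁
rotate-injective {x = suc i} {suc j} eq = cong suc (Fin.inject₁-injective eq)

rotate-deranged : (i : Fin (2 + n)) → rotate i ≢ i
rotate-deranged zero    ()
rotate-deranged (suc i) eq = ℕ.1+n≢n (trans (sym (cong toℕ eq)) (Fin.toℕ-inject₁ i))

-- Of the 4 + m + e colours, 1, …, n with n = 2 + m are those of the children; the i-th branch
-- carries, as long as there is one, the spare colour n + 1 + i at a grandchild.
nice-step : ∀ m e → e < 2 + m → {c : TV (2 + m) (suc k) → Fin (3 + (m + e))} → Nice c →
  Σ (TV (2 + m) (2 + k) → Fin (4 + (m + e))) Nice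
nice-step {k} m e e<n nice = Next.c⁺ , Next.nice⁺
  where
  q s : Fin (2 + m) → Fin (4 + (m + e))
  q i = suc (inject≤ i (s≤s (s≤s (m≤n⇒m≤1+n (ℕ.m≤m+n m e)))))
  s i with 3 + m + toℕ i ℕ.<? 4 + (m + e)
  ... | yes i-spare = fromℕ< i-spare
  -- Once the spare colours run out, 0 is a safe filler, since every `q j` is nonzero.
  ... | no  _       = zero

  toℕ-q : ∀ i → toℕ (q i) ≡ suc (toℕ i)
  toℕ-q i = cong suc (Fin.toℕ-inject≤ i _)

  q-injective : Injective _≡_ _≡_ q
  q-injective = Fin.inject≤-injective _ _ _ _ ∘ Fin.suc-injective

  q≢s : ∀ i j → q i ≢ s j
  q≢s i j eq with 3 + m + toℕ j ℕ.<? 4 + (m + e)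
  ... | yes j-spare = ℕ.<⇒≢ (s≤s (≤-trans (Fin.toℕ<n i) (ℕ.m≤m+n (2 + m) (toℕ j))))
    (trans (sym (toℕ-q i)) (trans (cong toℕ eq) (Fin.toℕ-fromℕ< j-spare)))
  ... | no  _       = contradiction eq λ ()

  s-spare : ∀ i x → 3 + m + toℕ i ≡ toℕ x → s i ≡ x
  s-spare i x eq with 3 + m + toℕ i ℕ.<? 4 + (m + e)
  ... | yes i-spare = Fin.toℕ-injective (trans (Fin.toℕ-fromℕ< i-spare) eq)
  ... | no  ¬spare  = contradiction (subst (_< 4 + (m + e)) (sym eq) (Fin.toℕ<n x)) ¬spare

  palette : ∀ x → (x ≡ zero) ⊎ (∃[ i ] q i ≡ x) ⊎ (∃[ i ] s i ≡ x)
  palette zero = inj₁ refl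
  palette (suc x) with toℕ x ℕ.<? 2 + m
  ... | yes x<n = inj₂ (inj₁ (fromℕ< x<n ,
          Fin.toℕ-injective (trans (toℕ-q _) (cong suc (Fin.toℕ-fromℕ< x<n)))))
  ... | no  x≮n = inj₂ (inj₂ (fromℕ< index<n , s-spare _ (suc x)
          (cong suc (trans (cong (2 + m +_) (Fin.toℕ-fromℕ< index<n)) (ℕ.m+[n∸m]≡n (ℕ.≮⇒≥ x≮n))))))
    where
    -- The `1 + e` spare colours fit into the `2 + m` branches.
    index<n : toℕ x ∸ (2 + m) < 2 + m
    index<n = ℕ.≤-<-trans (ℕ.m≤n+o⇒m∸n≤o _ (2 + m) (s≤s⁻¹ (Fin.toℕ<n x))) e<n

  module Next = Step nice rotate rotate-injective rotate-deranged q s q-injective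
    (λ _ ()) q≢s zero refl palette

-- `e` counts the levels added to the two-level base, at one colour each.
nice-colouring : ∀ m e → e ≤ 2 + m → Σ (TV (2 + m) (2 + e) → Fin (3 + (m + e))) Nice
nice-colouring m zero    _   =
  subst (λ N → Σ (TV (2 + m) 2 → Fin (3 + N)) Nice) (sym (ℕ.+-identityʳ m)) (Base.c₂ m , Base.nice₂ m)
nice-colouring m (suc e) e<n =
  subst (λ N → Σ (TV (2 + m) (3 + e) → Fin (3 + N)) Nice) (sym (ℕ.+-suc m e))
    (nice-step m e e<n (proj₂ (nice-colouring m e (ℕ.<⇒≤ e<n))))

-- As `N ≤ n * 2`, the left side is at most `n ^ E` times a factor free of `n`, and `n` exceeds that
-- factor.
power-bound : ∀ n N s E → N ≤ n + E → E ≤ n → (2 * s) ^ E < n → (N * s) ^ E < n ^ suc E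
power-bound n N s E N≤n+E E≤n large = begin-strict
  (N * s) ^ E             ≤⟨ ℕ.^-monoˡ-≤ E (ℕ.*-monoˡ-≤ s N≤2n) ⟩
  (n * 2 * s) ^ E         ≡⟨ cong (_^ E) (ℕ.*-assoc n 2 s) ⟩
  (n * (2 * s)) ^ E       ≡⟨ ^-distribʳ-* n (2 * s) E ⟩
  n ^ E * (2 * s) ^ E     <⟨ ℕ.*-monoʳ-< (n ^ E) {{ℕ.m^n≢0 n E {{>-nonZero (ℕ.≤-<-trans z≤n large)}}}} large ⟩
  n ^ E * n               ≡⟨ ℕ.*-comm (n ^ E) n ⟩
  n ^ suc E               ∎
  where
  open ℕ.≤-Reasoning
  ^-distribʳ-* : ∀ a b o → (a * b) ^ o ≡ a ^ o * b ^ o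
  ^-distribʳ-* a b zero    = refl
  ^-distribʳ-* a b (suc o) = trans (cong (a * b *_) (^-distribʳ-* a b o)) (ℕ.[m*n]*[o*p]≡[m*o]*[n*p] a b _ _)
  N≤2n : N ≤ n * 2
  N≤2n = ≤-trans N≤n+E (≤-trans (ℕ.+-monoʳ-≤ n E≤n)
    (ℕ.≤-reflexive (sym (trans (ℕ.*-comm n 2) (cong (n +_) (ℕ.+-identityʳ n))))))

theorem2 : (k : ℕ) → 4 ≤ k →
    ∃[ B ] ((n : ℕ) → 2 ≤ n → B ≤ n → LocatingChromaticNumber (T n k) (n + k ∸ 1))
-- The summand `E` secures `E ≤ n` for both bounds; the other makes `n` exceed `(2 * s) ^ E`.
theorem2 (suc (suc E)) _ = E + suc ((2 * s) ^ E) , λ { n@(suc (suc m)) _ B≤n →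
    subst (LocatingChromaticNumber (T n (2 + E))) (sym (colours m))
      ( (let (c , nice) = nice-colouring m E (E≤n B≤n) in c , nice⇒locating nice)
      , λ { N (s≤s N≤n+E) (c , locating) → few-colours-impossible c locating E N≤n+E
              (power-bound n N s E N≤n+E (E≤n B≤n) (ℕ.m+n≤o⇒n≤o E B≤n)) })
    ; (suc zero) (s≤s ()) }
  where
  -- This is the number of values of a code entry: the distances from 0 to twice the number of
  -- levels.
  s : ℕ
  s = suc ((2 + E) + (2 + E))

  E≤n : ∀ {n} → E + suc ((2 * s) ^ E) ≤ n → E ≤ n
  E≤n = ℕ.m+n≤o⇒m≤o E

  colours : ∀ m → suc (m + (2 + E)) ≡ 3 + (m + E)
  colours m = cong suc (trans (ℕ.+-suc m (suc E)) (cong suc (ℕ.+-suc m E)))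
theorem2 (suc zero) (s≤s ())
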